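{- Let $\mathcal R$ be a minion, $k\in\mathbb N$ ($k\ge1$), and $(\mathbb A,\mathbb B)$ a PCSP template. Then the $k$-th level of the relaxation $\mathcal R$ (defined using the $k$-th saturated power) solves $\mathrm{PCSP}(\mathbb A,\mathbb B)$ if and only if there is a minion homomorphism from $\mathrm{lvl}_k\,\mathcal R$ to $\mathrm{Pol}(\mathbb A,\mathbb B)$.
   Context: An LC (label cover) instance $\mathcal D$ consists of a finite set $X$ of variables, a finite set $\mathcal D_x$ (domain) for each $x\in X$, and a finite list of constraints of the form $x=\alpha(y)$ with $x,y\in X$ and $\alpha:\mathcal D_y\to\mathcal D_x$ a function; it is discrete if it has no constraints. A minion $\mathcal R$ is a functor from finite sets to sets: it assigns a set $\mathcal R^{(D)}$ to each finite set $D$ and a map $\mathcal R^{(\alpha)}:\mathcal R^{(D)}\to\mathcal R^{(E)}$ to each function $\alpha:D\to E$ between finite sets, preserving identities and composition. A solution of $\mathcal D$ in $\mathcal R$ is a tuple $(r_x)_{x\in X}$ with $r_x\in\mathcal R^{(\mathcal D_x)}$ and $r_x=\mathcal R^{(\alpha)}(r_y)$ for every constraint $x=\alpha(y)$ of $\mathcal D$. A minion homomorphism $\mathcal R\to\mathcal S$ is a natural transformation, i.e. a family of functions $\xi^{(D)}:\mathcal R^{(D)}\to\mathcal S^{(D)}$ with $\xi^{(E)}\circ\mathcal R^{(\alpha)}=\mathcal S^{(\alpha)}\circ\xi^{(D)}$ for every $\alpha:D\to E$. The $k$-th saturated power $\mathrm{pow}_k\,\mathcal D$ is the LC instance with variable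 set $X^k$, domains $\mathcal D_{x_1x_2\dots x_k}=\mathcal D_{x_1}\times\cdots\times\mathcal D_{x_k}$, and the following constraints, where first all constraints $x=\mathrm{id}(x)$ ($x\in X$) are added to $\mathcal D$: (1) for every $k$-tuple of constraints $x_i=\alpha_i(y_i)$, $i=1,\dots,k$, of $\mathcal D$, the constraint $x_1\dots x_k=(\alpha_1\times\cdots\times\alpha_k)(y_1\dots y_k)$; (2) for every $x_1\dots x_k\in X^k$ and every function $\sigma:[k]\to[k]$, the constraint $x_{\sigma(1)}\dots x_{\sigma(k)}=\sigma^*(x_1\dots x_k)$, where $\sigma^*(d_1\dots d_k)=d_{\sigma(1)}\dots d_{\sigma(k)}$. The $k$-th level $\mathrm{lvl}_k\,\mathcal R$ of $\mathcal R$ is the minion defined as follows. Elements of $(\mathrm{lvl}_k\,\mathcal R)^{(C)}$ are triples $(\mathcal E,r,\omega)$ where $\mathcal E$ is a discrete LC instance with variable set $Y$; $r=(r_{\bar y})_{\bar y\in Y^k}$ is a solution of $\mathrm{pow}_k\,\mathcal E$ in $\mathcal R$; and $\omega=(\omega_{\bar y})_{\bar y\in Y^{k-1}}$ is a tuple with $\omega_{\bar y}\in\mathcal R^{(C\times\mathcal E_{y_1}\times\cdots\times\mathcal E_{y_{k-1}})}$ such that there exist $z\in Y$ and a map $\beta:\mathcal E_z\to C$ with $\omega_{\bar y}=\mathcal R^{(\beta\times\mathrm{id}\times\cdots\times\mathrm{id})}(r_{zy_1\dots y_{k-1}})$ for all $\bar y\in Y^{k-1}$. For $\alpha:C\to C'$,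 $(\mathrm{lvl}_k\,\mathcal R)^{(\alpha)}(\mathcal E,r,\omega)=(\mathcal E,r,\omega')$ with $\omega'_{\bar y}=\mathcal R^{(\alpha\times\mathrm{id}\times\cdots\times\mathrm{id})}(\omega_{\bar y})$. A structure $\mathbb A$ in a finite signature $\Sigma$ (a finite set of relation symbols $R$ with arities $\mathrm{ar}(R)\ge1$) consists of a nonempty finite set $A$ and a relation $R^{\mathbb A}\subseteq A^{\mathrm{ar}(R)}$ for each $R\in\Sigma$. A homomorphism is a relation-preserving map. A PCSP template is a pair $(\mathbb A,\mathbb B)$ of structures in the same finite signature such that there is a homomorphism $\mathbb A\to\mathbb B$. An instance $\mathcal I$ of $\mathrm{PCSP}(\mathbb A,\mathbb B)$ is a finite list of formal constraints $x_1\dots x_n\in R$ with $R\in\Sigma$, $n=\mathrm{ar}(R)$, and $x_i$ variables. A solution of $\mathcal I$ in $\mathbb B$ is a map $s$ from variables to $B$ with $s(x_1)\dots s(x_n)\in R^{\mathbb B}$ for each constraint. The LC instance $\mathrm{lc}_{\mathbb A}(\mathcal I)$ has as variables the variables of $\mathcal I$, each with domain $A$, together with one variable $y$ with domain $R^{\mathbb A}$ for each constraint $x_1\dots x_n\in R$ of $\mathcal I$, with LC constraints $x_i=\pi_i(y)$, $i=1,\dots,n$, where $\pi_i$ is the $i$-th projection. The $k$-th level of the relaxation $\mathcal R$ solves $\mathrm{PCSP}(\mathbb A,\mathbb B)$ if for every instance $\mathcal I$: if $\mathrm{pow}_k\,\mathrm{lc}_{\mathbb A}(\mathcal I)$ has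 a solution in $\mathcal R$, then $\mathcal I$ has a solution in $\mathbb B$. The polymorphism minion $\mathcal M=\mathrm{Pol}(\mathbb A,\mathbb B)$: $\mathcal M^{(D)}$ is the set of homomorphisms from the Cartesian power $\mathbb A^D$ (relations taken coordinatewise) to $\mathbb B$; for $\alpha:D\to E$ and $f\in\mathcal M^{(D)}$, $\mathcal M^{(\alpha)}(f):\mathbb A^E\to\mathbb B$ is $a\mapsto f(a\circ\alpha)$. -}

module Defs where

open import Data.Bool.Base using (Bool; true; false; T)
open import Data.Bool.Properties using (T-irrelevant)
open import Data.Fin.Base using (Fin; zero; suc)
open import Data.Fin.Properties using (*↔×; +↔⊎)
open import Data.List.Base as List using (List; []; _∷_; _++_; cartesianProductWith)
open import Data.List.Relation.Unary.All as ListAll using ()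
open import Data.List.Relation.Unary.Any using (Any)
open import Data.Nat.Base using (ℕ; zero; suc; _+_; _*_; _^_; NonZero)
open import Data.Product.Base using (Σ; ∃-syntax; Σ-syntax; _×_; _,_; proj₁; proj₂; map₁)
open import Data.Product.Function.NonDependent.Propositional using (_×-↔_)
open import Data.Sum.Base using (_⊎_; inj₁; inj₂; [_,_]′)
open import Data.Sum.Function.Propositional using (_⊎-↔_)
open import Data.Unit.Base using (tt)
open import Data.Vec.Base as Vec using (Vec; []; _∷_; lookup)
open import Data.Vec.Membership.Propositional using (_∈_)
open import Data.Vec.Relation.Unary.All using (All; []; _∷_)
open import Data.Vec.Relation.Unary.All.Properties using (lookup⁺)
open import Function.Base using (id; _∘_)
open import Function.Bundles using (Inverse; _↔_; mk↔ₛ′)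
open import Function.Properties.Inverse using (↔-refl; ↔-sym; ↔-trans)
open import Level using (Level; _⊔_; 0ℓ) renaming (suc to lsuc)
open import Relation.Binary.Bundles using (Setoid)
open import Relation.Binary.PropositionalEquality
  using (_≡_; refl; sym; trans; cong; subst; _≗_)

private
  variable
    c ℓ c₁ ℓ₁ c₂ ℓ₂ : Level

-- Functions on FinSets need not preserve the enumerations.
record FinSet : Set₁ where
  field
    ∣_∣         : Set
    size        : ℕ
    enumeration : ∣_∣ ↔ Fin size

open FinSet public using (∣_∣)

elements : (X : FinSet) → List ∣ X ∣
elements X = List.map (Inverse.from (FinSet.enumeration X)) (List.allFin (FinSet.size X))

finSet : (n : ℕ) → FinSet
finSet n = record { ∣_∣ = Fin n ; size = n ; enumeration = ↔-refl }

infixr 2 _×ᶠ_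
infixr 1 _⊎ᶠ_

_×ᶠ_ : FinSet → FinSet → FinSet
X ×ᶠ Y = record
  { ∣_∣         = ∣ X ∣ × ∣ Y ∣
  ; size        = FinSet.size X * FinSet.size Y
  ; enumeration = ↔-trans (FinSet.enumeration X ×-↔ FinSet.enumeration Y) (↔-sym *↔×)
  }

_⊎ᶠ_ : FinSet → FinSet → FinSet
X ⊎ᶠ Y = record
  { ∣_∣         = ∣ X ∣ ⊎ ∣ Y ∣
  ; size        = FinSet.size X + FinSet.size Y
  ; enumeration = ↔-trans (FinSet.enumeration X ⊎-↔ FinSet.enumeration Y) (↔-sym +↔⊎)
  }

infixl 8 _^ᶠ_

_^ᶠ_ : FinSet → ℕ → FinSet
X ^ᶠ k = record
  { ∣_∣         = Vec ∣ X ∣ k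
  ; size        = FinSet.size X ^ k
  ; enumeration = enum k
  }
  where
  enum : ∀ k → Vec ∣ X ∣ k ↔ Fin (FinSet.size X ^ k)
  enum zero    = mk↔ₛ′ (λ _ → zero) (λ _ → []) (λ { zero → refl }) (λ { [] → refl })
  enum (suc k) = ↔-trans split (↔-trans (FinSet.enumeration X ×-↔ enum k) (↔-sym *↔×))
    where
    split : Vec ∣ X ∣ (suc k) ↔ (∣ X ∣ × Vec ∣ X ∣ k)
    split = mk↔ₛ′ (λ { (x ∷ xs) → x , xs }) (λ { (x , xs) → x ∷ xs })
                  (λ _ → refl) (λ { (x ∷ xs) → refl })

-- ∏ D (x₁ ∷ … ∷ xₖ ∷ []) is D x₁ × ⋯ × D xₖ.  Tuples are inductive rather than
-- functions on Fin k, since without function extensionality the latter need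
-- not form a finite type.
∏ : ∀ {I : Set} (D : I → FinSet) {k} → Vec I k → FinSet
∏ {I} D xs = record
  { ∣_∣         = All (∣_∣ ∘ D) xs
  ; size        = Vec.foldr (λ _ → ℕ) (λ x n → FinSet.size (D x) * n) 1 xs
  ; enumeration = enum xs
  }
  where
  enum : ∀ {k} (xs : Vec I k) →
         All (∣_∣ ∘ D) xs ↔ Fin (Vec.foldr (λ _ → ℕ) (λ x n → FinSet.size (D x) * n) 1 xs)
  enum []       = mk↔ₛ′ (λ _ → zero) (λ _ → []) (λ { zero → refl }) (λ { [] → refl })
  enum (x ∷ xs) = ↔-trans split (↔-trans (FinSet.enumeration (D x) ×-↔ enum xs) (↔-sym *↔×))
    where
    split : All (∣_∣ ∘ D) (x ∷ xs) ↔ (∣ D x ∣ × All (∣_∣ ∘ D) xs)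
    split = mk↔ₛ′ (λ { (d ∷ ds) → d , ds }) (λ { (d , ds) → d ∷ ds })
                  (λ _ → refl) (λ { (d ∷ ds) → refl })

private
  Σ-T-≡ : ∀ {A : Set} {p : A → Bool} {u v : Σ A (T ∘ p)} → proj₁ u ≡ proj₁ v → u ≡ v
  Σ-T-≡ {u = _ , s} {v = _ , t} refl = cong (_ ,_) (T-irrelevant s t)

  finSubset : ∀ {n} (p : Fin n → Bool) → Σ[ m ∈ ℕ ] (Σ (Fin n) (T ∘ p) ↔ Fin m)
  finSubset {zero}  p = 0 , mk↔ₛ′ (λ ()) (λ ()) (λ ()) (λ ())
  finSubset {suc n} p = extend (p zero) refl
    where
    m = proj₁ (finSubset (p ∘ suc))
    open Inverse (proj₂ (finSubset (p ∘ suc)))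
      using (to; from; strictlyInverseˡ; strictlyInverseʳ)

    up : Σ (Fin n) (T ∘ p ∘ suc) → Σ (Fin (suc n)) (T ∘ p)
    up (i , t) = suc i , t

    extend : ∀ b → p zero ≡ b → Σ[ m ∈ ℕ ] (Σ (Fin (suc n)) (T ∘ p) ↔ Fin m)
    extend true e = suc m , mk↔ₛ′ f g fg gf
      where
      f : Σ (Fin (suc n)) (T ∘ p) → Fin (suc m)
      f (zero  , _) = zero
      f (suc i , t) = suc (to (i , t))
      g : Fin (suc m) → Σ (Fin (suc n)) (T ∘ p)
      g zero    = zero , subst T (sym e) tt
      g (suc j) = up (from j)
      fg : ∀ j → f (g j) ≡ j
      fg zero    = refl
      fg (suc j) = cong suc (strictlyInverseˡ j)
      gf : ∀ u → g (f u) ≡ u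
      gf (zero  , _) = Σ-T-≡ refl
      gf (suc i , t) = cong up (strictlyInverseʳ (i , t))
    extend false e = m , mk↔ₛ′ f (up ∘ from) strictlyInverseˡ gf
      where
      f : Σ (Fin (suc n)) (T ∘ p) → Fin m
      f (zero  , t) with () ← subst T e t
      f (suc i , t) = to (i , t)
      gf : ∀ u → up (from (f u)) ≡ u
      gf (zero  , t) with () ← subst T e t
      gf (suc i , t) = cong up (strictlyInverseʳ (i , t))

subset : (X : FinSet) → (∣ X ∣ → Bool) → FinSet
subset X p = record
  { ∣_∣         = Σ ∣ X ∣ (T ∘ p)
  ; size        = proj₁ (finSubset (p ∘ from))
  ; enumeration = ↔-trans reindex (proj₂ (finSubset (p ∘ from)))
  }
  where
  open Inverse (FinSet.enumeration X) using (to; from; strictlyInverseˡ; strictlyInverseʳ)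
  reindex : Σ ∣ X ∣ (T ∘ p) ↔ Σ (Fin (FinSet.size X)) (T ∘ p ∘ from)
  reindex = mk↔ₛ′
    (λ (x , t) → to x , subst (T ∘ p) (sym (strictlyInverseʳ x)) t)
    (λ (i , t) → from i , t)
    (λ (i , _) → Σ-T-≡ (strictlyInverseˡ i))
    (λ (x , _) → Σ-T-≡ (strictlyInverseʳ x))

-- The constraint  target = map (source).
record Constraint (X : FinSet) (D : ∣ X ∣ → FinSet) : Set where
  constructor constraint
  field
    target source : ∣ X ∣
    map           : ∣ D source ∣ → ∣ D target ∣

record LC : Set₁ where
  field
    vars        : FinSet
    dom         : ∣ vars ∣ → FinSet
    constraints : List (Constraint vars dom)

Discrete : LC → Set
Discrete 𝓓 = LC.constraints 𝓓 ≡ []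

tuples : ∀ {a} {A : Set a} → List A → (k : ℕ) → List (Vec A k)
tuples xs zero    = [] ∷ []
tuples xs (suc k) = cartesianProductWith _∷_ xs (tuples xs k)

module _ {X : FinSet} {D : ∣ X ∣ → FinSet} where
  open Constraint

  idConstraint : ∣ X ∣ → Constraint X D
  idConstraint x = constraint x x id

  productMap : ∀ {k} (cs : Vec (Constraint X D) k) →
               ∣ ∏ D (Vec.map source cs) ∣ → ∣ ∏ D (Vec.map target cs) ∣
  productMap []       []       = []
  productMap (c ∷ cs) (d ∷ ds) = map c d ∷ productMap cs ds

  productConstraint : ∀ {k} → Vec (Constraint X D) k → Constraint (X ^ᶠ k) (∏ D)
  productConstraint cs =
    constraint (Vec.map target cs) (Vec.map source cs) (productMap cs)

  -- A function σ : [l] → [k] is given as the vector of its values.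
  reindex : ∀ {k l} (σ : Vec (Fin k) l) {xs : Vec ∣ X ∣ k} →
            ∣ ∏ D xs ∣ → ∣ ∏ D (Vec.map (lookup xs) σ) ∣
  reindex []      ds = []
  reindex (i ∷ σ) ds = lookup⁺ ds i ∷ reindex σ ds

  reindexConstraint : ∀ {k} → Vec ∣ X ∣ k → Vec (Fin k) k → Constraint (X ^ᶠ k) (∏ D)
  reindexConstraint xs σ = constraint (Vec.map (lookup xs) σ) xs (reindex σ)

-- Two enumerated lists of constraints: products of k constraints, after adding
-- all x = id(x), and reindexings along all σ : [k] → [k].
pow : ℕ → LC → LC
pow k 𝓓 = record
  { vars        = vars ^ᶠ k
  ; dom         = ∏ dom
  ; constraints =
      List.map productConstraint
        (tuples (constraints ++ List.map idConstraint (elements vars)) k)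
      ++
      cartesianProductWith reindexConstraint
        (tuples (elements vars) k) (tuples (List.allFin k) k)
  }
  where open LC 𝓓

-- Sets are modelled as setoids.  As there is no function extensionality,
-- functoriality includes that the action depends on a function between finite
-- sets only through its values (map-cong).

record Minion (c ℓ : Level) : Set (lsuc (c ⊔ ℓ)) where
  field
    obj : FinSet → Setoid c ℓ

  Elem : FinSet → Set c
  Elem D = Setoid.Carrier (obj D)

  infix 4 _≈_
  _≈_ : ∀ {D} → Elem D → Elem D → Set ℓ
  _≈_ {D} = Setoid._≈_ (obj D)

  field
    map      : ∀ {D E} → (∣ D ∣ → ∣ E ∣) → Elem D → Elem E
    map-resp : ∀ {D E} (α : ∣ D ∣ → ∣ E ∣) {r s : Elem D} →
               r ≈ s → map {D} {E} α r ≈ map α s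
    map-cong : ∀ {D E} {α β : ∣ D ∣ → ∣ E ∣} → α ≗ β →
               (r : Elem D) → map {D} {E} α r ≈ map β r
    map-id   : ∀ {D} (r : Elem D) → map {D} {D} id r ≈ r
    map-∘    : ∀ {D E F} (β : ∣ E ∣ → ∣ F ∣) (α : ∣ D ∣ → ∣ E ∣) (r : Elem D) →
               map {D} {F} (β ∘ α) r ≈ map {E} {F} β (map {D} {E} α r)

record MinionHom (𝓡 : Minion c₁ ℓ₁) (𝓢 : Minion c₂ ℓ₂) :
                 Set (lsuc 0ℓ ⊔ c₁ ⊔ ℓ₁ ⊔ c₂ ⊔ ℓ₂) where
  private
    module R = Minion 𝓡
    module S = Minion 𝓢
  field
    ξ       : ∀ D → R.Elem D → S.Elem D
    ξ-resp  : ∀ D {r s : R.Elem D} → R._≈_ {D} r s → S._≈_ {D} (ξ D r) (ξ D s)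
    natural : ∀ {D E} (α : ∣ D ∣ → ∣ E ∣) (r : R.Elem D) →
              S._≈_ {E} (ξ E (R.map {D} {E} α r)) (S.map {D} {E} α (ξ D r))

record Solution (𝓓 : LC) (𝓡 : Minion c ℓ) : Set (c ⊔ ℓ) where
  open LC 𝓓
  open Minion 𝓡
  open Constraint using (target; source)
  field
    value     : (x : ∣ vars ∣) → Elem (dom x)
    satisfies : ListAll.All
                  (λ e → _≈_ {dom (target e)} (value (target e))
                           (Minion.map 𝓡 {dom (source e)} {dom (target e)}
                             (Constraint.map e) (value (source e))))
                  constraints

module _ (n : ℕ) (𝓡 : Minion c ℓ) where
  open Minion 𝓡

  -- Triples (𝓔 , r , ω), for the level suc n.
  record Triple (C : FinSet) : Set (lsuc 0ℓ ⊔ c ⊔ ℓ) where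
    constructor triple
    field
      𝓔          : LC
      𝓔-discrete : Discrete 𝓔
      r          : Solution (pow (suc n) 𝓔) 𝓡
    open LC 𝓔
    field
      ω         : (ys : Vec ∣ vars ∣ n) → Elem (C ×ᶠ ∏ dom ys)
      ω-induced : ∃[ z ] Σ[ β ∈ (∣ dom z ∣ → ∣ C ∣) ] ∀ ys →
                  _≈_ {C ×ᶠ ∏ dom ys} (ω ys)
                    (map {∏ dom (z ∷ ys)} {C ×ᶠ ∏ dom ys}
                      (λ { (e ∷ es) → β e , es }) (Solution.value r (z ∷ ys)))

  -- Equality of triples; it ignores the proofs, in particular the witnesses of
  -- the mere existence statement ω-induced.
  data _≈ₜ_ {C : FinSet} : Triple C → Triple C → Set (lsuc 0ℓ ⊔ c ⊔ ℓ) where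
    same : ∀ {𝓔 : LC} {d d′ : Discrete 𝓔} {r r′ : Solution (pow (suc n) 𝓔) 𝓡} {ω ω′ i i′} →
           (∀ xs → _≈_ {∏ (LC.dom 𝓔) xs} (Solution.value r xs) (Solution.value r′ xs)) →
           (∀ ys → _≈_ {C ×ᶠ ∏ (LC.dom 𝓔) ys} (ω ys) (ω′ ys)) →
           triple 𝓔 d r ω i ≈ₜ triple 𝓔 d′ r′ ω′ i′

  private
    module S D = Setoid (obj D)

    tripleSetoid : FinSet → Setoid (lsuc 0ℓ ⊔ c ⊔ ℓ) (lsuc 0ℓ ⊔ c ⊔ ℓ)
    tripleSetoid C = record
      { Carrier       = Triple C
      ; _≈_           = _≈ₜ_
      ; isEquivalence = record
        { refl  = same (λ _ → S.refl _) (λ _ → S.refl _)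
        ; sym   = λ { (same p q) → same (λ xs → S.sym _ (p xs)) (λ ys → S.sym _ (q ys)) }
        ; trans = λ { (same p q) (same p′ q′) →
                      same (λ xs → S.trans _ (p xs) (p′ xs)) (λ ys → S.trans _ (q ys) (q′ ys)) }
        }
      }

    push : ∀ {C C′} → (∣ C ∣ → ∣ C′ ∣) → Triple C → Triple C′
    push {C} {C′} α (triple 𝓔 d r ω (z , β , eq)) = triple 𝓔 d r
      (λ ys → map {C ×ᶠ ∏ (LC.dom 𝓔) ys} {C′ ×ᶠ ∏ (LC.dom 𝓔) ys} (map₁ α) (ω ys))
      (z , α ∘ β , λ ys →
        S.trans _ (map-resp (map₁ α) (eq ys))
          (S.trans _ (S.sym _ (map-∘ (map₁ α) _ _))
            (map-cong (λ { (e ∷ es) → refl }) _)))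

  lvlSuc : Minion (lsuc 0ℓ ⊔ c ⊔ ℓ) (lsuc 0ℓ ⊔ c ⊔ ℓ)
  lvlSuc = record
    { obj      = tripleSetoid
    ; map      = push
    ; map-resp = λ { α (same p q) → same p (λ ys → map-resp (map₁ α) (q ys)) }
    ; map-cong = λ eq t → same (λ _ → S.refl _)
                   (λ ys → map-cong (λ (e , es) → cong (_, es) (eq e)) (Triple.ω t ys))
    ; map-id   = λ t → same (λ _ → S.refl _) (λ ys → map-id (Triple.ω t ys))
    ; map-∘    = λ β α t → same (λ _ → S.refl _)
                   (λ ys → map-∘ (map₁ β) (map₁ α) (Triple.ω t ys))
    }

lvl : (k : ℕ) .{{_ : NonZero k}} → Minion c ℓ → Minion (lsuc 0ℓ ⊔ c ⊔ ℓ) (lsuc 0ℓ ⊔ c ⊔ ℓ)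
lvl (suc n) = lvlSuc n

record Signature : Set₁ where
  field
    symbols    : FinSet
    ar         : ∣ symbols ∣ → ℕ
    ar-nonZero : ∀ R → NonZero (ar R)

record Structure (𝚺 : Signature) : Set₁ where
  open Signature 𝚺
  field
    universe   : FinSet
    inhabitant : ∣ universe ∣
    rel        : (R : ∣ symbols ∣) → Vec ∣ universe ∣ (ar R) → Bool

  relation : ∣ symbols ∣ → FinSet
  relation R = subset (universe ^ᶠ ar R) (rel R)

module _ {𝚺 : Signature} where
  open Signature 𝚺

  record Hom (𝔸 𝔹 : Structure 𝚺) : Set where
    private
      module A = Structure 𝔸
      module B = Structure 𝔹
    field
      fun       : ∣ A.universe ∣ → ∣ B.universe ∣
      preserves : ∀ R t → T (A.rel R t) → T (B.rel R (Vec.map fun t))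

  -- Homomorphisms 𝔸ᴰ → 𝔹.  Elements of the power are functions D → A up to
  -- pointwise equality, which polymorphisms therefore have to respect.
  record Polymorphism (𝔸 𝔹 : Structure 𝚺) (D : FinSet) : Set where
    private
      module A = Structure 𝔸
      module B = Structure 𝔹
    field
      fun       : (∣ D ∣ → ∣ A.universe ∣) → ∣ B.universe ∣
      fun-cong  : ∀ {a b} → a ≗ b → fun a ≡ fun b
      preserves : ∀ R (t : Vec (∣ D ∣ → ∣ A.universe ∣) (ar R)) →
                  (∀ d → T (A.rel R (Vec.map (λ a → a d) t))) →
                  T (B.rel R (Vec.map fun t))

  Pol : Structure 𝚺 → Structure 𝚺 → Minion 0ℓ 0ℓ
  Pol 𝔸 𝔹 = record
    { obj = λ D → record
        { Carrier       = Polymorphism 𝔸 𝔹 D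
        ; _≈_           = λ f g → fun f ≗ fun g
        ; isEquivalence = record
          { refl  = λ _ → refl
          ; sym   = λ p a → sym (p a)
          ; trans = λ p q a → trans (p a) (q a)
          }
        }
    ; map = λ α f → record
        { fun       = λ a → fun f (a ∘ α)
        ; fun-cong  = λ a≗b → fun-cong f (a≗b ∘ α)
        ; preserves = λ R t h →
            subst (T ∘ Structure.rel 𝔹 R) (sym (map-∘ (fun f) (_∘ α) t))
              (preserves f R (Vec.map (_∘ α) t) (λ d →
                subst (T ∘ Structure.rel 𝔸 R) (map-∘ (λ a → a d) (_∘ α) t) (h (α d))))
        }
    ; map-resp = λ α p a → p (a ∘ α)
    ; map-cong = λ α≗β f a → fun-cong f (λ d → cong a (α≗β d))
    ; map-id   = λ f a → refl
    ; map-∘    = λ β α f a → refl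
    }
    where
    open Polymorphism
    open import Data.Vec.Properties using (map-∘)

record PCSPTemplate : Set₁ where
  field
    signature : Signature
    𝔸 𝔹       : Structure signature
    hom       : Hom 𝔸 𝔹

-- An instance is its list of constraints: vars consists exactly of the variables
-- occurring in it.
record Instance (𝚺 : Signature) : Set₁ where
  open Signature 𝚺
  field
    vars        : FinSet
    constraints : List (Σ[ R ∈ ∣ symbols ∣ ] Vec ∣ vars ∣ (ar R))
    occurs      : ∀ x → Any (λ (_ , xs) → x ∈ xs) constraints

module _ {𝚺 : Signature} where
  open Signature 𝚺

  record SolutionIn (𝔹 : Structure 𝚺) (𝓘 : Instance 𝚺) : Set where
    open Instance 𝓘
    open Structure 𝔹
    field
      value     : ∣ vars ∣ → ∣ universe ∣
      satisfies : ListAll.All (λ (R , xs) → T (rel R (Vec.map value xs))) constraints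

  lc : Structure 𝚺 → Instance 𝚺 → LC
  lc 𝔸 𝓘 = record
    { vars        = lcVars
    ; dom         = lcDom
    ; constraints = List.concatMap (λ j → List.map (projection j) (List.allFin _))
                      (List.allFin (List.length constraints))
    }
    where
    open Instance 𝓘
    open Structure 𝔸

    lcVars : FinSet
    lcVars = vars ⊎ᶠ finSet (List.length constraints)

    symbol : Fin (List.length constraints) → ∣ symbols ∣
    symbol j = proj₁ (List.lookup constraints j)

    scope : ∀ j → Vec ∣ vars ∣ (ar (symbol j))
    scope j = proj₂ (List.lookup constraints j)

    lcDom : ∣ lcVars ∣ → FinSet
    lcDom = [ (λ _ → universe) , (λ j → relation (symbol j)) ]′

    projection : ∀ j → Fin (ar (symbol j)) → Constraint lcVars lcDom
    projection j i =
      constraint (inj₁ (lookup (scope j) i)) (inj₂ j) (λ (t , _) → lookup t i)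

LevelSolves : ℕ → Minion c ℓ → PCSPTemplate → Set (lsuc 0ℓ ⊔ c ⊔ ℓ)
LevelSolves k 𝓡 𝕋 =
  (𝓘 : Instance signature) → Solution (pow k (lc 𝔸 𝓘)) 𝓡 → SolutionIn 𝔹 𝓘
  where open PCSPTemplate 𝕋

module Submission where

-- Fix a solution r of pow_k 𝓔 for a discrete 𝓔.  A generator of C is a pair of z ∈ Y
-- and β : 𝓔_z → C; two generators are equivalent when they induce the same ω.  Since r
-- is invariant under permutations of coordinates, equivalent generators may be exchanged
-- in any coordinate of a k-tuple; so a choice of generators for the variables of an LC
-- instance which respects its constraints up to equivalence yields a solution of its
-- k-th power.
--
-- If the level solves the template, consider the instance whose variables are the classes
-- of generators of A, with one constraint for each z, R and τ : 𝓔_z → R^𝔸, on the classes of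
-- the pairs (z, πᵢ ∘ τ).  Its LC instance is respected in this sense, so it has a solution
-- s in 𝔹, and (𝓔, r, ω) is sent to the polymorphism a ↦ s(z, a ∘ β), where (z, β) induces ω.
--
-- Conversely, a solution r of pow_k (lc 𝓘) gives for every variable x the triple with
-- ω_ȳ = r_{xȳ}; a homomorphism ξ sends it to a polymorphism f_x, and x ↦ f_x(id) solves 𝓘.

open import Defs
open import Axiom.ExcludedMiddle using (ExcludedMiddle)
open import Data.Nat.Base using (ℕ; NonZero)
open import Function.Bundles using (_⇔_)

open import Data.Bool.Base using (Bool; true; false; T)
open import Data.Bool.ListAction using (all; and)
open import Data.Bool.Properties using (T-irrelevant)
open import Data.Fin.Base using (Fin; zero; suc)
import Data.Fin.Properties as Finₚ
open import Data.List.Base as List using (List; []; _∷_; _++_; findᵇ)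
open import Data.List.Membership.Propositional using (find; lose) renaming (_∈_ to _∈ˡ_)
open import Data.List.Membership.Propositional.Properties
  using (∈-cartesianProductWith⁺; ∈-cartesianProductWith⁻; ∈-map⁺; ∈-map⁻; ∈-++⁺ˡ; ∈-++⁺ʳ; ∈-++⁻;
         ∈-allFin; ∈-concatMap⁺; ∈-concatMap⁻; ∈-lookup)
import Data.List.Properties as Listₚ
open import Data.List.Relation.Unary.All as ListAll using ()
open import Data.List.Relation.Unary.All.Properties as ListAllₚ using ()
open import Data.List.Relation.Unary.Any using (here; there; index)
open import Data.List.Relation.Unary.Any.Properties using (lookup-index)
open import Data.Maybe.Base using (Maybe; just; maybe)
open import Data.Maybe.Properties as Maybeₚ using (just-injective)
open import Data.Nat.Base using (zero; suc; ≢-nonZero⁻¹)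
open import Data.Product.Base using (Σ; ∃; ∃-syntax; Σ-syntax; _×_; _,_; proj₁; proj₂; map₁)
open import Data.Sum.Base using (inj₁; inj₂)
open import Data.Vec.Base as Vec using (Vec; []; _∷_; lookup)
open import Data.Vec.Membership.Propositional using () renaming (_∈_ to _∈ᵛ_)
open import Data.Vec.Membership.Propositional.Properties using (∈-tabulate⁺)
import Data.Vec.Properties as Vecₚ
open import Data.Vec.Relation.Unary.All as All using (All; []; _∷_)
open import Data.Vec.Relation.Unary.All.Properties as Allₚ using (lookup⁺)
open import Function.Base using (id; _∘_)
open import Function.Bundles using (Inverse; mk⇔)
open import Level using (Level)
open import Relation.Binary.Bundles using (Setoid)
open import Relation.Binary.Construct.Closure.ReflexiveTransitive using (Star; ε; _◅_; gmap)
open import Relation.Binary.PropositionalEquality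
  using (_≡_; refl; sym; trans; cong; cong₂; subst; _≗_)
import Relation.Binary.Reasoning.Setoid as SetoidReasoning
open import Relation.Nullary using (Dec; yes; no; does; contradiction)
open import Relation.Nullary.Decidable using (T?; dec-true; does-⇔)

private
  variable
    a p c ℓ : Level

-- Enumerations of tuples and of finite sets.

∈-tuples⁺ : ∀ {A : Set a} {xs : List A} {k} {v : Vec A k} → All (_∈ˡ xs) v → v ∈ˡ tuples xs k
∈-tuples⁺ []       = here refl
∈-tuples⁺ (x ∷ v) = ∈-cartesianProductWith⁺ _∷_ x (∈-tuples⁺ v)

∈-tuples⁻ : ∀ {A : Set a} {xs : List A} {k} {v : Vec A k} → v ∈ˡ tuples xs k → All (_∈ˡ xs) v
∈-tuples⁻ {k = 0}     {[]} _ = []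
∈-tuples⁻ {xs = xs} {suc k} v∈
  with _ , _ , x∈ , v∈ , refl ← ∈-cartesianProductWith⁻ _∷_ xs (tuples xs k) v∈ =
  x∈ ∷ ∈-tuples⁻ v∈

∀-lookup⇒all : ∀ {A : Set a} {P : A → Set p} {xs} →
               (∀ i → P (List.lookup xs i)) → ListAll.All P xs
∀-lookup⇒all {P = P} f = ListAll.tabulate λ x∈ → subst P (sym (lookup-index x∈)) (f (index x∈))

∈-elements : ∀ X (x : ∣ X ∣) → x ∈ˡ elements X
∈-elements X x = subst (_∈ˡ elements X) (strictlyInverseʳ x) (∈-map⁺ from (∈-allFin (to x)))
  where open Inverse (FinSet.enumeration X)

-- Rearranging the coordinates of tuples.

module _ {X : FinSet} {D : ∣ X ∣ → FinSet} where

  -- The type of tag ds does not depend on xs, so reindexed tuples can be compared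
  -- without transports.
  tag : ∀ {k} {xs : Vec ∣ X ∣ k} → ∣ ∏ D xs ∣ → Vec (Σ ∣ X ∣ (∣_∣ ∘ D)) k
  tag = All.reduce (λ {x} d → x , d)

  tag-injective : ∀ {k} {xs : Vec ∣ X ∣ k} (ds es : ∣ ∏ D xs ∣) → tag ds ≡ tag es → ds ≡ es
  tag-injective []       []       _  = refl
  tag-injective (d ∷ ds) (e ∷ es) eq with refl ← cong Vec.head eq =
    cong (d ∷_) (tag-injective ds es (cong Vec.tail eq))

  lookup-tag : ∀ {k} {xs : Vec ∣ X ∣ k} (ds : ∣ ∏ D xs ∣) i →
               lookup (tag ds) i ≡ (lookup xs i , lookup⁺ ds i)
  lookup-tag (d ∷ ds) zero    = refl
  lookup-tag (d ∷ ds) (suc i) = lookup-tag ds i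

  tag-reindex : ∀ {k l} (σ : Vec (Fin k) l) {xs : Vec ∣ X ∣ k} (ds : ∣ ∏ D xs ∣) →
                tag (reindex {X} {D} σ ds) ≡ Vec.map (lookup (tag ds)) σ
  tag-reindex []      ds = refl
  tag-reindex (i ∷ σ) ds = cong₂ _∷_ (sym (lookup-tag ds i)) (tag-reindex σ ds)

  -- The codomain is tied to `σ` by an equation, so that vectors of another form, such as vectors of
  -- sources of generators, qualify without transports.
  Rearrangement : ∀ {k l} (xs : Vec ∣ X ∣ k) (ys : Vec ∣ X ∣ l) → (∣ ∏ D xs ∣ → ∣ ∏ D ys ∣) → Set
  Rearrangement {k} {l} xs ys f =
    Σ[ σ ∈ Vec (Fin k) l ]
      Vec.map (lookup xs) σ ≡ ys × (∀ ds → tag (f ds) ≡ Vec.map (lookup (tag ds)) σ)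

  rearrangement-id : ∀ {k} (xs : Vec ∣ X ∣ k) → Rearrangement xs xs id
  rearrangement-id xs =
    Vec.allFin _ , Vecₚ.map-lookup-allFin xs , λ ds → sym (Vecₚ.map-lookup-allFin (tag ds))

  swapped : ∀ {k l x y} {xs : Vec ∣ X ∣ k} {ys : Vec ∣ X ∣ l} →
            (∣ ∏ D (x ∷ xs) ∣ → ∣ ∏ D ys ∣) → ∣ ∏ D (x ∷ y ∷ xs) ∣ → ∣ ∏ D (y ∷ ys) ∣
  swapped f (d ∷ e ∷ ds) = e ∷ f (d ∷ ds)

  rearrangement-swapped : ∀ {k l x y} {xs : Vec ∣ X ∣ k} {ys : Vec ∣ X ∣ l} f →
    Rearrangement (x ∷ xs) ys f → Rearrangement (x ∷ y ∷ xs) (y ∷ ys) (swapped f)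
  rearrangement-swapped {k} f (σ , eq , eqs) =
    -- The new head `y` sits at position 1 of the domain. `skip` keeps position 0, that of `x`, and
    -- shifts the remaining ones past `y`.
    suc zero ∷ Vec.map skip σ ,
    cong (_ ∷_) (trans (lookup-skip _ σ) eq) ,
    λ { (d ∷ e ∷ ds) → cong (_ ∷_) (trans (eqs (d ∷ ds)) (sym (lookup-skip _ σ))) }
    where
    skip : Fin (suc k) → Fin (suc (suc k))
    skip zero    = zero
    skip (suc i) = suc (suc i)

    lookup-skip : ∀ {A : Set} {l} {x y} (v : Vec A k) (σ : Vec (Fin (suc k)) l) →
                  Vec.map (lookup (x ∷ y ∷ v)) (Vec.map skip σ) ≡ Vec.map (lookup (x ∷ v)) σ
    lookup-skip v σ = trans (sym (Vecₚ.map-∘ _ skip σ))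
      (Vecₚ.map-cong (λ { zero → refl ; (suc i) → refl }) σ)

  -- Stated for an arbitrary P since map target (map idConstraint xs) agrees with
  -- xs only propositionally.
  productMap-idConstraints : ∀ {k} (ys : Vec ∣ X ∣ k)
    (P : ∀ xs zs → (∣ ∏ D zs ∣ → ∣ ∏ D {k} xs ∣) → Set p) →
    (∀ {xs zs f g} → f ≗ g → P xs zs f → P xs zs g) →
    let cs = Vec.map (idConstraint {X} {D}) ys in
    P (Vec.map Constraint.target cs) (Vec.map Constraint.source cs) (productMap {X} {D} cs) →
    P ys ys id
  productMap-idConstraints []       P ext P-cs = ext (λ { [] → refl }) P-cs
  productMap-idConstraints (y ∷ ys) P ext P-cs =
    ext (λ { (d ∷ ds) → refl })
      (productMap-idConstraints ys (λ xs zs f → P (y ∷ xs) (y ∷ zs) (λ { (d ∷ ds) → d ∷ f ds }))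
        (λ f≗g → ext (λ { (d ∷ ds) → cong (d ∷_) (f≗g ds) }))
        (ext (λ { (d ∷ ds) → refl }) P-cs))

-- Solutions of saturated powers as families of elements.

module MinionProperties (𝓡 : Minion c ℓ) where
  open Minion 𝓡 public
  module Eq D = Setoid (obj D)

  module _ (𝓓 : LC) where
    open LC 𝓓

    Family : ℕ → Set c
    Family k = (xs : Vec ∣ vars ∣ k) → Elem (∏ dom xs)

    module _ {k} (v : Family k) where

      _⊨_ : Constraint (vars ^ᶠ k) (∏ dom) → Set ℓ
      _⊨_ e = _≈_ {∏ dom (target e)} (v (target e))
                (map {∏ dom (source e)} {∏ dom (target e)} (Constraint.map e) (v (source e)))
        where open Constraint using (target; source)

      Reindexed : Set ℓ
      Reindexed = ∀ xs σ → _⊨_ (reindexConstraint xs σ)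

      Multiplied : Set ℓ
      Multiplied = ∀ (cs : Vec (Constraint vars dom) k) →
        All (_∈ˡ constraints ++ List.map idConstraint (elements vars)) cs → _⊨_ (productConstraint cs)

      satisfies⁺ : Multiplied → Reindexed → ListAll.All _⊨_ (LC.constraints (pow k 𝓓))
      satisfies⁺ mul re = ListAllₚ.++⁺
        (ListAllₚ.map⁺ (ListAll.tabulate (λ cs∈ → mul _ (∈-tuples⁻ cs∈))))
        (ListAll.tabulate λ e∈ → reindexed (∈-cartesianProductWith⁻ reindexConstraint
           (tuples (elements vars) k) (tuples (List.allFin k) k) e∈))
        where
        reindexed : ∀ {e} → (∃ λ xs → ∃ λ σ → _ × _ × e ≡ reindexConstraint xs σ) → _⊨_ e
        reindexed (xs , σ , _ , _ , refl) = re xs σ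

      satisfies⁻ : ListAll.All _⊨_ (LC.constraints (pow k 𝓓)) → Multiplied × Reindexed
      satisfies⁻ sat =
        (λ cs cs∈ → ListAll.lookup sat (∈-++⁺ˡ (∈-map⁺ productConstraint (∈-tuples⁺ cs∈)))) ,
        (λ xs σ → ListAll.lookup sat (∈-++⁺ʳ _ (∈-cartesianProductWith⁺ reindexConstraint
           (∈-tuples⁺ (All.universal (∈-elements vars) xs))
           (∈-tuples⁺ (All.universal ∈-allFin σ)))))

      idConstraint-∈ : ∀ x → idConstraint x ∈ˡ constraints ++ List.map idConstraint (elements vars)
      idConstraint-∈ x = ∈-++⁺ʳ _ (∈-map⁺ idConstraint (∈-elements vars x))

      Related : ∀ (xs zs : Vec ∣ vars ∣ k) → (∣ ∏ dom zs ∣ → ∣ ∏ dom xs ∣) → Set ℓ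
      Related xs zs f = _≈_ {∏ dom xs} (v xs) (map {∏ dom zs} {∏ dom xs} f (v zs))

      related-cong : ∀ {xs zs f g} → f ≗ g → Related xs zs f → Related xs zs g
      related-cong {xs} f≗g eq = Eq.trans (∏ dom xs) eq (map-cong f≗g _)

      -- By injectivity of `tag`, `f` agrees pointwise with `reindex σ`, so the reindexing
      -- constraint for `σ` carries over to it.
      rearranged : Reindexed → ∀ {xs : Vec ∣ vars ∣ k} {ys f} →
                   Rearrangement {vars} {dom} xs ys f → Related ys xs f
      rearranged re {xs} {ys} {f} (σ , refl , eqs) = related-cong
        (λ ds → tag-injective {vars} {dom} (reindex σ ds) (f ds)
          (trans (tag-reindex {vars} {dom} σ ds) (sym (eqs ds))))
        (re xs σ)

    module _ {k} (v : Family (suc k)) where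
      open Constraint using (target; source)

      actHead : ∀ (e : Constraint vars dom) {ys : Vec ∣ vars ∣ k} →
                ∣ ∏ dom (source e ∷ ys) ∣ → ∣ ∏ dom (target e ∷ ys) ∣
      actHead e (d ∷ ds) = Constraint.map e d ∷ ds

      -- The product of `e` with the identity constraints of `ys` changes the first coordinate only.
      headConstraint : Multiplied v → ∀ {e} → e ∈ˡ constraints → ∀ ys →
                       Related v (target e ∷ ys) (source e ∷ ys) (actHead e)
      headConstraint mul {e} e∈ ys = related-cong v (λ { (d ∷ ds) → refl })
        (productMap-idConstraints ys
          (λ xs zs f → Related v (target e ∷ xs) (source e ∷ zs)
            (λ { (d ∷ ds) → Constraint.map e d ∷ f ds }))
          (λ f≗g → related-cong v (λ { (d ∷ ds) → cong (_ ∷_) (f≗g ds) }))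
          (related-cong v (λ { (d ∷ ds) → refl })
            (mul (e ∷ Vec.map idConstraint ys)
              (∈-++⁺ˡ e∈ ∷ Allₚ.map⁺ (All.universal (idConstraint-∈ v) ys)))))

  -- Generators and their equivalence.

  module Generators (𝓔 : LC) {n} (v : Family 𝓔 (suc n)) where
    open LC 𝓔

    Generator : FinSet → Set
    Generator C = Σ[ z ∈ ∣ vars ∣ ] (∣ dom z ∣ → ∣ C ∣)

    push : ∀ {C C′} → (∣ C ∣ → ∣ C′ ∣) → Generator C → Generator C′
    push α (z , β) = z , α ∘ β

    applyHead : ∀ {C z} → (∣ dom z ∣ → ∣ C ∣) → ∀ {ys : Vec ∣ vars ∣ n} →
                ∣ ∏ dom (z ∷ ys) ∣ → ∣ C ×ᶠ ∏ dom ys ∣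
    applyHead β (e ∷ es) = β e , es

    induced : ∀ {C} → Generator C → ∀ ys → Elem (C ×ᶠ ∏ dom ys)
    induced {C} (z , β) ys =
      map {∏ dom (z ∷ ys)} {C ×ᶠ ∏ dom ys} (applyHead {C} β) (v (z ∷ ys))

    infix 4 _∼_
    _∼_ : ∀ {C} → Generator C → Generator C → Set ℓ
    _∼_ {C} g h = ∀ ys → _≈_ {C ×ᶠ ∏ dom ys} (induced {C} g ys) (induced {C} h ys)

    ∼-refl : ∀ {C} {g : Generator C} → _∼_ {C} g g
    ∼-refl {C} ys = Eq.refl (C ×ᶠ ∏ dom ys)

    ∼-sym : ∀ {C} {g h : Generator C} → _∼_ {C} g h → _∼_ {C} h g
    ∼-sym {C} p ys = Eq.sym (C ×ᶠ ∏ dom ys) (p ys)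

    ∼-trans : ∀ {C} {g h i : Generator C} → _∼_ {C} g h → _∼_ {C} h i → _∼_ {C} g i
    ∼-trans {C} p q ys = Eq.trans (C ×ᶠ ∏ dom ys) (p ys) (q ys)

    ≗⇒∼ : ∀ {C z} {β γ : ∣ dom z ∣ → ∣ C ∣} → β ≗ γ → _∼_ {C} (z , β) (z , γ)
    ≗⇒∼ β≗γ ys = map-cong (λ { (e ∷ es) → cong (_, es) (β≗γ e) }) _

    induced-push : ∀ {C C′} (α : ∣ C ∣ → ∣ C′ ∣) (g : Generator C) ys →
      _≈_ {C′ ×ᶠ ∏ dom ys} (induced {C′} (push {C} {C′} α g) ys)
        (map {C ×ᶠ ∏ dom ys} {C′ ×ᶠ ∏ dom ys} (map₁ α) (induced {C} g ys))
    induced-push {C} {C′} α g ys = Eq.trans (C′ ×ᶠ ∏ dom ys)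
      (map-cong (λ { (e ∷ es) → refl }) _) (map-∘ (map₁ α) (applyHead {C} (proj₂ g)) _)

    push-∼ : ∀ {C C′} (α : ∣ C ∣ → ∣ C′ ∣) {g h : Generator C} → _∼_ {C} g h →
             _∼_ {C′} (push {C} {C′} α g) (push {C} {C′} α h)
    push-∼ {C} {C′} α {g} {h} p ys = begin
      induced {C′} (push {C} {C′} α g) ys ≈⟨ induced-push {C} {C′} α g ys ⟩
      _                                   ≈⟨ map-resp (map₁ α) (p ys) ⟩
      _                                   ≈⟨ induced-push {C} {C′} α h ys ⟨
      induced {C′} (push {C} {C′} α h) ys ∎
      where open SetoidReasoning (obj (C′ ×ᶠ ∏ dom ys))

    -- Exchanging equivalent generators inside a tuple.

    module Products {I : FinSet} (D : ∣ I ∣ → FinSet) where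

      Generators : ∀ {k} → Vec ∣ I ∣ k → Set
      Generators = All (Generator ∘ D)

      sources : ∀ {k} {xs : Vec ∣ I ∣ k} → Generators xs → Vec ∣ vars ∣ k
      sources = All.reduce proj₁

      act : ∀ {k} {xs : Vec ∣ I ∣ k} (gs : Generators xs) → ∣ ∏ dom (sources gs) ∣ → ∣ ∏ D xs ∣
      act []             []       = []
      act ((_ , β) ∷ gs) (e ∷ es) = β e ∷ act gs es

      data Step : ∀ {k} {xs : Vec ∣ I ∣ k} → Generators xs → Generators xs → Set ℓ where
        here  : ∀ {k x} {xs : Vec ∣ I ∣ k} {g h : Generator (D x)} {gs : Generators xs} →
                _∼_ {D x} g h → Step (g ∷ gs) (h ∷ gs)
        there : ∀ {k x} {xs : Vec ∣ I ∣ k} {g : Generator (D x)} {gs hs : Generators xs} →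
                Step gs hs → Step {xs = x ∷ xs} (g ∷ gs) (g ∷ hs)

      data Pointwise : ∀ {k} {xs : Vec ∣ I ∣ k} → Generators xs → Generators xs → Set ℓ where
        []  : Pointwise [] []
        _∷_ : ∀ {k x} {xs : Vec ∣ I ∣ k} {g h : Generator (D x)} {gs hs : Generators xs} →
              _∼_ {D x} g h → Pointwise gs hs → Pointwise (g ∷ gs) (h ∷ hs)

      -- Equivalence speaks of one generator next to unchanged variables, so a change in all
      -- coordinates has to be made one coordinate at a time.
      pointwise⇒steps : ∀ {k} {xs : Vec ∣ I ∣ k} {gs hs : Generators xs} →
                        Pointwise gs hs → Star Step gs hs
      pointwise⇒steps []       = ε
      pointwise⇒steps (p ∷ ps) = here p ◅ gmap (_ ∷_) there (pointwise⇒steps ps)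

      -- act gs factors through moving the source of g to the front and applying g to it;
      -- φ and us do not mention g, so an equivalent generator may take its place.
      record Factors {k x} {xs : Vec ∣ I ∣ (suc k)} (us : Vec ∣ vars ∣ k)
                     (φ : ∣ D x ∣ × ∣ ∏ dom us ∣ → ∣ ∏ D xs ∣)
                     (g : Generator (D x)) (gs : Generators xs) : Set where
        field
          move          : ∣ ∏ dom (proj₁ g ∷ us) ∣ → ∣ ∏ dom (sources gs) ∣
          rearrangement : Rearrangement {vars} {dom} (proj₁ g ∷ us) (sources gs) move
          act-move      : ∀ e es → act gs (move (e ∷ es)) ≡ φ (proj₂ g e , es)
      open Factors

      factors-here : ∀ {k x} {xs : Vec ∣ I ∣ k} (g : Generator (D x)) (gs : Generators xs) →
        Factors (sources gs) (λ (d , es) → d ∷ act gs es) g (g ∷ gs)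
      factors-here g gs = record
        { move          = id
        ; rearrangement = rearrangement-id {vars} {dom} _
        ; act-move      = λ _ _ → refl
        }

      -- The source of `h` joins the variables `us`, and the application of `h` is absorbed into
      -- `φ`; still neither depends on `g`.
      factors-there : ∀ {k x y} {xs : Vec ∣ I ∣ (suc k)} {us φ g} {gs : Generators xs}
        (h : Generator (D y)) →
        Factors {x = x} us φ g gs →
        Factors (proj₁ h ∷ us) (λ { (d , e ∷ es) → proj₂ h e ∷ φ (d , es) }) g (h ∷ gs)
      factors-there h F = record
        { move          = swapped {vars} {dom} (move F)
        ; rearrangement = rearrangement-swapped {vars} {dom} (move F) (rearrangement F)
        ; act-move      = λ { d (e ∷ es) → cong (_ ∷_) (act-move F d es) }
        }

      step-factors : ∀ {k} {xs : Vec ∣ I ∣ (suc k)} {gs hs : Generators xs} → Step gs hs →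
        ∃ λ x → ∃ λ us → ∃ λ φ → ∃ λ g → ∃ λ h →
          _∼_ {D x} g h × Factors {x = x} us φ g gs × Factors {x = x} us φ h hs
      step-factors (here p) = _ , _ , _ , _ , _ , p , factors-here _ _ , factors-here _ _
      step-factors {suc k} (there s)
        with _ , _ , _ , _ , _ , p , F , F′ ← step-factors s =
        _ , _ , _ , _ , _ , p , factors-there _ F , factors-there _ F′
      step-factors {zero} (there ())

      module _ (re : Reindexed 𝓔 v) where

        image : {xs : Vec ∣ I ∣ (suc n)} → Generators xs → Elem (∏ D xs)
        image {xs} gs = map {∏ dom (sources gs)} {∏ D xs} (act gs) (v (sources gs))

        -- Invariance of `v` brings the source of `g` to the front; functoriality then splits off
        -- the application of `g`, which exposes `induced g us`. Only this element depends on `g`,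
        -- up to `≈`.
        factors-image : ∀ {x} {xs : Vec ∣ I ∣ (suc n)} {us φ g} {gs : Generators xs} →
          Factors {x = x} us φ g gs →
          _≈_ {∏ D xs} (image gs) (map {D x ×ᶠ ∏ dom us} {∏ D xs} φ (induced {D x} g us))
        factors-image {x} {xs} {us} {φ} {g} {gs} F = begin
          image gs ≈⟨ map-resp (act gs) (rearranged 𝓔 v re (rearrangement F)) ⟩
          map {∏ dom (sources gs)} {∏ D xs} (act gs)
            (map {∏ dom (proj₁ g ∷ us)} {∏ dom (sources gs)} (move F) (v (proj₁ g ∷ us)))
                   ≈⟨ map-∘ (act gs) (move F) _ ⟨
          map {∏ dom (proj₁ g ∷ us)} {∏ D xs} (act gs ∘ move F) (v (proj₁ g ∷ us))
                   ≈⟨ map-cong (λ { (e ∷ es) → act-move F e es }) _ ⟩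
          map {∏ dom (proj₁ g ∷ us)} {∏ D xs} (φ ∘ applyHead {D x} (proj₂ g)) (v (proj₁ g ∷ us))
                   ≈⟨ map-∘ φ (applyHead {D x} (proj₂ g)) _ ⟩
          map {D x ×ᶠ ∏ dom us} {∏ D xs} φ (induced {D x} g us) ∎
          where open SetoidReasoning (obj (∏ D xs))

        step-image : {xs : Vec ∣ I ∣ (suc n)} {gs hs : Generators xs} →
                     Step gs hs → _≈_ {∏ D xs} (image gs) (image hs)
        step-image {xs} s with _ , us , φ , _ , _ , p , F , F′ ← step-factors s =
          Eq.trans (∏ D xs) (factors-image F)
            (Eq.trans (∏ D xs) (map-resp φ (p us)) (Eq.sym (∏ D xs) (factors-image F′)))

        steps-image : {xs : Vec ∣ I ∣ (suc n)} {gs hs : Generators xs} →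
                      Star Step gs hs → _≈_ {∏ D xs} (image gs) (image hs)
        steps-image {xs} ε        = Eq.refl (∏ D xs)
        steps-image {xs} (s ◅ ss) = Eq.trans (∏ D xs) (step-image s) (steps-image ss)

    -- Solutions of powers from compatible generators.

    module _ (re : Reindexed 𝓔 v) (𝓓 : LC)
             (gen : (x : ∣ LC.vars 𝓓 ∣) → Generator (LC.dom 𝓓 x)) where
      open Constraint using (target; source)
      private
        module D = LC 𝓓
      open Products {D.vars} D.dom

      Compatible : Constraint D.vars D.dom → Set ℓ
      Compatible e = _∼_ {D.dom (target e)} (gen (target e))
        (push {D.dom (source e)} {D.dom (target e)} (Constraint.map e) (gen (source e)))

      gens : ∀ {k} (xs : Vec ∣ D.vars ∣ k) → Generators xs
      gens = All.universal gen

      lookupSource : ∀ {k} (xs : Vec ∣ D.vars ∣ k) i → ∣ ∏ dom (sources (gens xs)) ∣ →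
                     ∣ dom (proj₁ (gen (lookup xs i))) ∣
      lookupSource (x ∷ xs) zero    (e ∷ _)  = e
      lookupSource (x ∷ xs) (suc i) (_ ∷ es) = lookupSource xs i es

      -- `reindex σ` on the sources has a codomain that equals the required one only
      -- propositionally; recursion gives the map at the right type.
      reindexSource : ∀ {k l} (xs : Vec ∣ D.vars ∣ k) (σ : Vec (Fin k) l) →
        ∣ ∏ dom (sources (gens xs)) ∣ → ∣ ∏ dom (sources (gens (Vec.map (lookup xs) σ))) ∣
      reindexSource xs []      es = []
      reindexSource xs (i ∷ σ) es = lookupSource xs i es ∷ reindexSource xs σ es

      lookup-sources : ∀ {k} (xs : Vec ∣ D.vars ∣ k) i →
        lookup (sources (gens xs)) i ≡ proj₁ (gen (lookup xs i))
      lookup-sources (x ∷ xs) zero    = refl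
      lookup-sources (x ∷ xs) (suc i) = lookup-sources xs i

      sources-reindex : ∀ {k l} (xs : Vec ∣ D.vars ∣ k) (σ : Vec (Fin k) l) →
        Vec.map (lookup (sources (gens xs))) σ ≡ sources (gens (Vec.map (lookup xs) σ))
      sources-reindex xs []      = refl
      sources-reindex xs (i ∷ σ) = cong₂ _∷_ (lookup-sources xs i) (sources-reindex xs σ)

      lookup-tag-source : ∀ {k} (xs : Vec ∣ D.vars ∣ k) i es →
        (_ , lookupSource xs i es) ≡ lookup (tag {vars} {dom} es) i
      lookup-tag-source (x ∷ xs) zero    (e ∷ es) = refl
      lookup-tag-source (x ∷ xs) (suc i) (e ∷ es) = lookup-tag-source xs i es

      tag-reindexSource : ∀ {k l} (xs : Vec ∣ D.vars ∣ k) (σ : Vec (Fin k) l) es →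
        tag {vars} {dom} (reindexSource xs σ es) ≡ Vec.map (lookup (tag {vars} {dom} es)) σ
      tag-reindexSource xs []      es = refl
      tag-reindexSource xs (i ∷ σ) es =
        cong₂ _∷_ (lookup-tag-source xs i es) (tag-reindexSource xs σ es)

      act-lookupSource : ∀ {k} (xs : Vec ∣ D.vars ∣ k) i es →
        proj₂ (gen (lookup xs i)) (lookupSource xs i es) ≡ lookup⁺ (act (gens xs) es) i
      act-lookupSource (x ∷ xs) zero    (e ∷ es) = refl
      act-lookupSource (x ∷ xs) (suc i) (e ∷ es) = act-lookupSource xs i es

      act-reindexSource : ∀ {k l} (xs : Vec ∣ D.vars ∣ k) (σ : Vec (Fin k) l) es →
        act (gens (Vec.map (lookup xs) σ)) (reindexSource xs σ es) ≡
        reindex {D.vars} {D.dom} σ (act (gens xs) es)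
      act-reindexSource xs []      es = refl
      act-reindexSource xs (i ∷ σ) es =
        cong₂ _∷_ (act-lookupSource xs i es) (act-reindexSource xs σ es)

      generatedFamily : Family 𝓓 (suc n)
      generatedFamily xs = image re (gens xs)

      generatedFamily-reindexed : Reindexed 𝓓 generatedFamily
      generatedFamily-reindexed xs σ = begin
        image re (gens xs′)
          ≈⟨ map-resp (act (gens xs′)) (rearranged 𝓔 v re
               (σ , sources-reindex xs σ , tag-reindexSource xs σ)) ⟩
        map {∏ dom (sources (gens xs′))} {∏ D.dom xs′} (act (gens xs′))
          (map {∏ dom (sources (gens xs))} {∏ dom (sources (gens xs′))} (reindexSource xs σ) _)
          ≈⟨ map-∘ (act (gens xs′)) (reindexSource xs σ) _ ⟨
        map {∏ dom (sources (gens xs))} {∏ D.dom xs′} (act (gens xs′) ∘ reindexSource xs σ) _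
          ≈⟨ map-cong (act-reindexSource xs σ) _ ⟩
        map {∏ dom (sources (gens xs))} {∏ D.dom xs′} (reindex {D.vars} {D.dom} σ ∘ act (gens xs)) _
          ≈⟨ map-∘ (reindex {D.vars} {D.dom} σ) (act (gens xs)) _ ⟩
        map {∏ D.dom xs} {∏ D.dom xs′} (reindex {D.vars} {D.dom} σ) (image re (gens xs)) ∎
        where
        xs′ = Vec.map (lookup xs) σ
        open SetoidReasoning (obj (∏ D.dom xs′))

      pushed : ∀ {k} (cs : Vec (Constraint D.vars D.dom) k) → Generators (Vec.map target cs)
      pushed []       = []
      pushed (e ∷ cs) =
        push {D.dom (source e)} {D.dom (target e)} (Constraint.map e) (gen (source e)) ∷ pushed cs

      pushed-pointwise : ∀ {k} {cs : Vec (Constraint D.vars D.dom) k} →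
        All Compatible cs → Pointwise (gens (Vec.map target cs)) (pushed cs)
      pushed-pointwise []       = []
      pushed-pointwise (p ∷ ps) = p ∷ pushed-pointwise ps

      -- This is the identity on entries: pushing a generator keeps its source, but the two vectors
      -- of sources agree only propositionally.
      pull : ∀ {k} (cs : Vec (Constraint D.vars D.dom) k) →
        ∣ ∏ dom (sources (gens (Vec.map source cs))) ∣ → ∣ ∏ dom (sources (pushed cs)) ∣
      pull []       []       = []
      pull (_ ∷ cs) (e ∷ es) = e ∷ pull cs es

      pull-sources : ∀ {k} (cs : Vec (Constraint D.vars D.dom) k) →
        sources (gens (Vec.map source cs)) ≡ sources (pushed cs)
      pull-sources []       = refl
      pull-sources (_ ∷ cs) = cong (_ ∷_) (pull-sources cs)

      tag-pull : ∀ {k} (cs : Vec (Constraint D.vars D.dom) k) es →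
        tag {vars} {dom} (pull cs es) ≡ tag {vars} {dom} es
      tag-pull []       []       = refl
      tag-pull (_ ∷ cs) (e ∷ es) = cong (_ ∷_) (tag-pull cs es)

      act-pull : ∀ {k} (cs : Vec (Constraint D.vars D.dom) k) es →
        act (pushed cs) (pull cs es) ≡
        productMap {D.vars} {D.dom} cs (act (gens (Vec.map source cs)) es)
      act-pull []       []       = refl
      act-pull (_ ∷ cs) (e ∷ es) = cong (_ ∷_) (act-pull cs es)

      -- The generators of the targets are first exchanged for the equivalent pushed ones. These
      -- have the sources of the generators of the constraint sources, and acting by them is acting
      -- by the latter followed by `productMap cs`.
      generatedFamily-product : ∀ cs → All Compatible cs →
        _⊨_ 𝓓 generatedFamily (productConstraint cs)
      generatedFamily-product cs compatible = begin
        image re (gens xs)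
          ≈⟨ steps-image re (pointwise⇒steps (pushed-pointwise compatible)) ⟩
        image re (pushed cs)
          ≈⟨ map-resp (act (pushed cs)) (rearranged 𝓔 v re
               (Vec.allFin _ , trans (Vecₚ.map-lookup-allFin _) (pull-sources cs) ,
                λ es → trans (tag-pull cs es) (sym (Vecₚ.map-lookup-allFin _)))) ⟩
        map {∏ dom (sources (pushed cs))} {∏ D.dom xs} (act (pushed cs))
          (map {∏ dom (sources (gens ys))} {∏ dom (sources (pushed cs))} (pull cs) _)
          ≈⟨ map-∘ (act (pushed cs)) (pull cs) _ ⟨
        map {∏ dom (sources (gens ys))} {∏ D.dom xs} (act (pushed cs) ∘ pull cs) _
          ≈⟨ map-cong (act-pull cs) _ ⟩
        map {∏ dom (sources (gens ys))} {∏ D.dom xs}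
          (productMap {D.vars} {D.dom} cs ∘ act (gens ys)) _
          ≈⟨ map-∘ (productMap {D.vars} {D.dom} cs) (act (gens ys)) _ ⟩
        map {∏ D.dom ys} {∏ D.dom xs} (productMap {D.vars} {D.dom} cs) (image re (gens ys)) ∎
        where
        xs = Vec.map target cs
        ys = Vec.map source cs
        open SetoidReasoning (obj (∏ D.dom xs))

      generatedSolution : ListAll.All Compatible D.constraints → Solution (pow (suc n) 𝓓) 𝓡
      generatedSolution compatible = record
        { value     = generatedFamily
        ; satisfies = satisfies⁺ 𝓓 generatedFamily
            (λ cs cs∈ → generatedFamily-product cs (All.map compatible⁺ cs∈))
            generatedFamily-reindexed
        }
        where
        compatible⁺ : ∀ {e} → e ∈ˡ D.constraints ++ List.map idConstraint (elements D.vars) →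
                      Compatible e
        compatible⁺ e∈ with ∈-++⁻ D.constraints e∈
        ... | inj₁ e∈cs = ListAll.lookup compatible e∈cs
        -- Pushing along `id` leaves a generator unchanged, so the added identity constraints are
        -- compatible by reflexivity.
        ... | inj₂ e∈ids with x , _ , refl ← ∈-map⁻ idConstraint e∈ids = ∼-refl {D.dom x} {gen x}

-- From a homomorphism to a solution of the instance.

discrete : LC → LC
discrete 𝓓 = record { LC 𝓓 ; constraints = [] }

module HomomorphismSolves {c ℓ} (𝓡 : Minion c ℓ) (n : ℕ) (𝕋 : PCSPTemplate) where
  open PCSPTemplate 𝕋
  open Signature signature
  open MinionProperties 𝓡 hiding (map; map-∘)
  private
    module A = Structure 𝔸
    module B = Structure 𝔹
    module L = Minion (lvlSuc n 𝓡)

  module _ (hom : MinionHom (lvlSuc n 𝓡) (Pol 𝔸 𝔹)) (𝓘 : Instance signature)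
           (s : Solution (pow (suc n) (lc 𝔸 𝓘)) 𝓡) where
    open MinionHom hom
    open Instance 𝓘
    open Polymorphism using (fun; preserves)
    private
      𝓓 = lc 𝔸 𝓘
      module D = LC 𝓓
      v = Solution.value s

    multiplied-reindexed : Multiplied 𝓓 v × Reindexed 𝓓 v
    multiplied-reindexed = satisfies⁻ 𝓓 v (Solution.satisfies s)

    open Generators (discrete 𝓓) v

    -- The products of identity constraints and the reindexings that remain are among the
    -- constraints of the power of `𝓓`.
    restriction : Solution (pow (suc n) (discrete 𝓓)) 𝓡
    restriction = record
      { value     = v
      ; satisfies = satisfies⁺ (discrete 𝓓) v
          (λ cs cs∈ → proj₁ multiplied-reindexed cs (All.map (∈-++⁺ʳ D.constraints) cs∈))
          (proj₂ multiplied-reindexed)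
      }

    variableTriple : ∀ x → L.Elem (D.dom x)
    variableTriple x = triple (discrete 𝓓) refl restriction (induced {D.dom x} (x , id))
      (x , id , λ ys → map-cong (λ { (e ∷ es) → refl }) _)

    -- Both triples share `𝓔` and `r`, and equality of triples ignores the inducing generators, here
    -- `(source , map)` and `(target , id)`. It remains to compare the `ω`, which is what
    -- `headConstraint` does.
    variableTriple-constraint : ∀ {e} → e ∈ˡ D.constraints →
      L._≈_ {D.dom (Constraint.target e)}
        (L.map {D.dom (Constraint.source e)} {D.dom (Constraint.target e)} (Constraint.map e)
          (variableTriple (Constraint.source e)))
        (variableTriple (Constraint.target e))
    variableTriple-constraint {e} e∈ =
      same (λ xs → Eq.refl (∏ D.dom xs)) (λ ys → Eq.sym (D.dom target ×ᶠ ∏ D.dom ys) (ω-eq ys))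
      where
      open Constraint e

      ω-eq : ∀ ys → _≈_ {D.dom target ×ᶠ ∏ D.dom ys} (induced {D.dom target} (target , id) ys)
        (Minion.map 𝓡 {D.dom source ×ᶠ ∏ D.dom ys} {D.dom target ×ᶠ ∏ D.dom ys}
          (map₁ map) (induced {D.dom source} (source , id) ys))
      ω-eq ys = begin
        induced {D.dom target} (target , id) ys
          ≈⟨ map-resp (applyHead {D.dom target} id)
               (headConstraint 𝓓 v (proj₁ multiplied-reindexed) e∈ ys) ⟩
        _ ≈⟨ Minion.map-∘ 𝓡 (applyHead {D.dom target} id) (actHead 𝓓 v e) _ ⟨
        _ ≈⟨ map-cong (λ { (d ∷ ds) → refl }) _ ⟩
        induced {D.dom target} (source , map) ys
          ≈⟨ induced-push {D.dom source} {D.dom target} map (source , id) ys ⟩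
        _ ∎
        where open SetoidReasoning (obj (D.dom target ×ᶠ ∏ D.dom ys))

    value : ∣ vars ∣ → ∣ B.universe ∣
    value x = fun (ξ A.universe (variableTriple (inj₁ x))) id

    homSolves : SolutionIn 𝔹 𝓘
    homSolves = record
      { value     = value
      ; satisfies = ∀-lookup⇒all λ j →
          let R , xs = List.lookup constraints j
              g      = ξ (A.relation R) (variableTriple (inj₂ j))
              π      = λ (i : Fin (ar R)) (u : ∣ A.relation R ∣) → lookup (proj₁ u) i
          -- At each `u` the projections `π i` form the tuple `u` of the relation, so `g` maps them
          -- into the relation of `𝔹`. Naturality along `π i` and the triple equality for the `i`-th
          -- projection identify `g (π i)` with the value at the `i`-th variable.
          in subst (T ∘ B.rel R)
            (trans (sym (Vecₚ.tabulate-∘ (fun g) π))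
              (trans (Vecₚ.tabulate-cong λ i → trans
                  (sym (natural {A.relation R} {A.universe} (π i) (variableTriple (inj₂ j)) id))
                  (ξ-resp A.universe (variableTriple-constraint (projection-∈ j i)) id))
                (trans (Vecₚ.tabulate-∘ value (lookup xs))
                  (cong (Vec.map value) (Vecₚ.tabulate∘lookup xs)))))
            (preserves g R (Vec.tabulate π) λ u → subst (T ∘ A.rel R)
              (trans (sym (Vecₚ.tabulate∘lookup (proj₁ u))) (Vecₚ.tabulate-∘ (λ a → a u) π))
              (proj₂ u))
      }
      where
      projection-∈ : ∀ j i → constraint (inj₁ (lookup (proj₂ (List.lookup constraints j)) i)) (inj₂ j)
                               (λ (t , _) → lookup t i) ∈ˡ D.constraints
      projection-∈ j i = ∈-concatMap⁺ _ (lose (∈-allFin j) (∈-map⁺ _ (∈-allFin i)))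

-- Finite lists of functions and Boolean search.

functions : (X Y : FinSet) → List (∣ X ∣ → ∣ Y ∣)
functions X Y = List.map (λ v → lookup v ∘ Inverse.to (FinSet.enumeration X))
                  (tuples (elements Y) (FinSet.size X))

-- The listed functions are read off tables of values, so `f` is met only up to `≗`.
∈-functions : ∀ {X Y} (f : ∣ X ∣ → ∣ Y ∣) → ∃[ g ] g ∈ˡ functions X Y × g ≗ f
∈-functions {X} {Y} f = _ ,
  ∈-map⁺ _ (∈-tuples⁺ (All.universal (∈-elements Y) (Vec.tabulate (f ∘ from)))) ,
  λ x → trans (Vecₚ.lookup∘tabulate (f ∘ from) (to x)) (cong f (strictlyInverseʳ x))
  where open Inverse (FinSet.enumeration X)

findᵇ-cong : ∀ {A : Set a} {P Q : A → Bool} → P ≗ Q → findᵇ P ≗ findᵇ Q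
findᵇ-cong         P≗Q []       = refl
findᵇ-cong {P = P} {Q} P≗Q (x ∷ xs) with P x | Q x | P≗Q x
... | true  | _ | refl = refl
... | false | _ | refl = findᵇ-cong P≗Q xs

findᵇ-∃ : ∀ {A : Set a} (P : A → Bool) {x xs} → x ∈ˡ xs → T (P x) →
          ∃[ y ] findᵇ P xs ≡ just y × T (P y)
findᵇ-∃ P {xs = y ∷ xs} x∈ Px with P y in eq
... | true = y , refl , subst T (sym eq) _
findᵇ-∃ P {xs = y ∷ xs} (here refl) Px | false with () ← subst T eq Px
findᵇ-∃ P {xs = y ∷ xs} (there x∈)  Px | false = findᵇ-∃ P x∈ Px

T-does⁺ : ∀ {A : Set a} (A? : Dec A) → A → T (does A?)
T-does⁺ A? x = subst T (sym (dec-true A? x)) _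

T-does⁻ : ∀ {A : Set a} (A? : Dec A) → T (does A?) → A
T-does⁻ (yes x) _ = x

all-cong : ∀ {A : Set a} {P Q : A → Bool} → P ≗ Q → all P ≗ all Q
all-cong P≗Q xs = cong and (Listₚ.map-cong P≗Q xs)

-- From solvability to a homomorphism: the listed generators.

module CanonicalSolution {c ℓ} (em : ExcludedMiddle ℓ)
                         (𝓡 : Minion c ℓ) (n : ℕ) (𝕋 : PCSPTemplate) where
  open PCSPTemplate 𝕋
  open Signature signature
  open MinionProperties 𝓡 hiding (map; map-∘; map-cong)
  private
    module A = Structure 𝔸
    module B = Structure 𝔹
    module L = Minion (lvlSuc n 𝓡)

  module Scopes (𝓔 : LC) where
    open LC 𝓔

    Generatorᴬ : Set
    Generatorᴬ = Σ[ z ∈ ∣ vars ∣ ] (∣ dom z ∣ → ∣ A.universe ∣)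

    Relator : Set
    Relator = Σ[ R ∈ ∣ symbols ∣ ] Σ[ z ∈ ∣ vars ∣ ] (∣ dom z ∣ → ∣ A.relation R ∣)

    arity : Relator → ℕ
    arity (R , _) = ar R

    coordinate : (p : Relator) → Fin (arity p) → Generatorᴬ
    coordinate (R , z , τ) i = z , λ e → lookup (proj₁ (τ e)) i

    opaque
      relators : List Relator
      relators = List.concatMap (λ R → List.concatMap (λ z →
        List.map (λ τ → R , z , τ) (functions (dom z) (A.relation R))) (elements vars)) (elements symbols)

      ∈-relators : ∀ R z (τ : ∣ dom z ∣ → ∣ A.relation R ∣) →
                   ∃[ τ′ ] (R , z , τ′) ∈ˡ relators × τ′ ≗ τ
      ∈-relators R z τ with τ′ , τ′∈ , τ′≗τ ← ∈-functions {dom z} {A.relation R} τ =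
        τ′ , ∈-concatMap⁺ _ (lose (∈-elements symbols R)
               (∈-concatMap⁺ _ (lose (∈-elements vars z) (∈-map⁺ _ τ′∈)))) , τ′≗τ

      -- Only coordinates of relators are listed, since every variable of an instance has to occur
      -- in a constraint.
      coordinates : List Generatorᴬ
      coordinates = List.concatMap (λ p → List.map (coordinate p) (List.allFin (arity p))) relators

      N : ℕ
      N = List.length coordinates

      nth : Fin N → Generatorᴬ
      nth = List.lookup coordinates

      nth-coordinate : ∀ j → ∃[ p ] ∃[ i ] p ∈ˡ relators × nth j ≡ coordinate p i
      nth-coordinate j
        with p , p∈ , nth∈ ← find (∈-concatMap⁻
               (λ p → List.map (coordinate p) (List.allFin (arity p))) {xs = relators} (∈-lookup j))
        with i , _ , eq ← ∈-map⁻ (coordinate p) nth∈ = p , i , p∈ , eq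

      coordinate-nth : ∀ ((R , z , τ) : Relator) i →
                       ∃[ j ] ∃[ τ′ ] τ′ ≗ τ × nth j ≡ coordinate (R , z , τ′) i
      coordinate-nth (R , z , τ) i
        with τ′ , p∈ , τ′≗τ ← ∈-relators R z τ =
        index coordinate∈ , τ′ , τ′≗τ , sym (lookup-index coordinate∈)
        where
        coordinate∈ : coordinate (R , z , τ′) i ∈ˡ coordinates
        coordinate∈ = ∈-concatMap⁺ _ (lose p∈ (∈-map⁺ (coordinate (R , z , τ′)) (∈-allFin i)))

    -- The instance on the classes of generators.

    module _ (v : Family 𝓔 (suc n)) where
      open Generators 𝓔 v hiding (_∼_)

      infix 4 _∼_
      _∼_ : Generatorᴬ → Generatorᴬ → Set ℓ
      _∼_ = Generators._∼_ 𝓔 v {A.universe}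

      infix 4 _∼ᵇ_
      -- Excluded middle enters here, turning equality in `𝓡` into a Boolean that a search can test.
      _∼ᵇ_ : Generatorᴬ → Generatorᴬ → Bool
      g ∼ᵇ h = does (em {g ∼ h})

      opaque
        -- The first equivalent index names the class, so equivalent generators get equal names. The
        -- result is `nothing` for generators equivalent to no listed coordinate.
        rep : Generatorᴬ → Maybe (Fin N)
        rep g = findᵇ (λ j → nth j ∼ᵇ g) (List.allFin N)

        rep-cong : ∀ {g h} → g ∼ h → rep g ≡ rep h
        rep-cong {g} {h} g∼h = findᵇ-cong
          (λ j → does-⇔ (mk⇔
            (λ p → ∼-trans {A.universe} {nth j} {g} {h} p g∼h)
            (λ p → ∼-trans {A.universe} {nth j} {h} {g} p (∼-sym {A.universe} {g} {h} g∼h))) em em)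
          (List.allFin N)

        rep-coordinate : ∀ p i → ∃[ j ] rep (coordinate p i) ≡ just j × nth j ∼ coordinate p i
        rep-coordinate p i
          with j , τ′ , τ′≗τ , eq ← coordinate-nth p i
          with j′ , eq′ , t ← findᵇ-∃ (λ j → nth j ∼ᵇ coordinate p i) (∈-allFin j)
            (T-does⁺ em (subst (_∼ coordinate p i) (sym eq)
              (≗⇒∼ {A.universe} (λ e → cong (λ u → lookup (proj₁ u) i) (τ′≗τ e))))) =
          j′ , eq′ , T-does⁻ em t

      opaque
        -- The quotient by `∼` is realised as the finite set of indices that represent themselves.
        isRep : Fin N → Bool
        isRep j = does (Maybeₚ.≡-dec Finₚ._≟_ (rep (nth j)) (just j))

        isRep⁺ : ∀ {j} → rep (nth j) ≡ just j → T (isRep j)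
        isRep⁺ {j} = T-does⁺ (Maybeₚ.≡-dec Finₚ._≟_ (rep (nth j)) (just j))

        isRep⁻ : ∀ {j} → T (isRep j) → rep (nth j) ≡ just j
        isRep⁻ {j} = T-does⁻ (Maybeₚ.≡-dec Finₚ._≟_ (rep (nth j)) (just j))

      classes : FinSet
      classes = subset (finSet N) isRep

      class : ∀ p → Fin (arity p) → ∣ classes ∣
      class p i = let j , eq , j∼ = rep-coordinate p i in
        -- `nth j` is equivalent to the coordinate that `j` represents, so its first representative
        -- is `j` as well.
        j , isRep⁺ (trans (rep-cong {nth j} j∼) eq)

      rep-class : ∀ p i → rep (coordinate p i) ≡ just (proj₁ (class p i))
      rep-class p i = proj₁ (proj₂ (rep-coordinate p i))

      class-∼ : ∀ p i → nth (proj₁ (class p i)) ∼ coordinate p i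
      class-∼ p i = proj₂ (proj₂ (rep-coordinate p i))

      class-surjective : ∀ x → ∃[ p ] ∃[ i ] p ∈ˡ relators × class p i ≡ x
      class-surjective (j , t) with p , i , p∈ , eq ← nth-coordinate j =
        p , i , p∈ , Σ-T-≡ (just-injective (trans (sym (rep-class p i))
          (trans (cong rep (sym eq)) (isRep⁻ t))))
        where
        Σ-T-≡ : ∀ {x y : ∣ classes ∣} → proj₁ x ≡ proj₁ y → x ≡ y
        Σ-T-≡ {_ , s} {_ , t} refl = cong (_ ,_) (T-irrelevant s t)

      scopedRelation : Relator → Σ[ R ∈ ∣ symbols ∣ ] Vec ∣ classes ∣ (ar R)
      scopedRelation p = proj₁ p , Vec.tabulate (class p)

      classInstance : Instance signature
      classInstance = record
        { vars        = classes
        ; constraints = List.map scopedRelation relators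
        ; occurs      = λ x → let p , i , p∈ , eq = class-surjective x in
            lose (∈-map⁺ scopedRelation p∈)
              (subst (_∈ᵛ Vec.tabulate (class p)) eq (∈-tabulate⁺ (class p) i))
        }

      module _ (re : Reindexed 𝓔 v) where
        private
          𝓓 = lc 𝔸 classInstance

        -- The generator is meant for the variable of a constraint, and the condition is its
        -- compatibility with the projections. Being a property of any constraint, it can be looked
        -- up in the mapped list without transports.
        RelationGenerator : Σ[ R ∈ ∣ symbols ∣ ] Vec ∣ classes ∣ (ar R) → Set ℓ
        RelationGenerator (R , xs) = Σ[ h ∈ Generator (A.relation R) ] ∀ i →
          nth (proj₁ (lookup xs i)) ∼ coordinate (R , h) i

        scopedRelation-generator : ∀ p → RelationGenerator (scopedRelation p)
        scopedRelation-generator p = proj₂ p , λ i → subst (λ x → nth (proj₁ x) ∼ coordinate p i)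
          (sym (Vecₚ.lookup∘tabulate (class p) i)) (class-∼ p i)

        relationGenerator : ∀ m → RelationGenerator (List.lookup (List.map scopedRelation relators) m)
        relationGenerator m = ListAll.lookup {P = RelationGenerator}
          (ListAllₚ.map⁺ {P = RelationGenerator} {f = scopedRelation}
            (ListAll.universal scopedRelation-generator relators))
          (∈-lookup {xs = List.map scopedRelation relators} m)

        gen : (x : ∣ LC.vars 𝓓 ∣) → Generator (LC.dom 𝓓 x)
        gen (inj₁ x) = nth (proj₁ x)
        gen (inj₂ m) = proj₁ (relationGenerator m)

        classSolution : Solution (pow (suc n) 𝓓) 𝓡
        classSolution = generatedSolution re 𝓓 gen
          (ListAllₚ.concat⁺ (ListAllₚ.map⁺ (ListAllₚ.tabulate⁺ λ m →
            ListAllₚ.map⁺ (ListAllₚ.tabulate⁺ λ i → proj₂ (relationGenerator m) i))))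

      -- A canonical choice of solution in `𝔹`.

      default : ∣ B.universe ∣
      default = Hom.fun hom A.inhabitant

      -- Assignments are vectors over all `N` indices and not over `classes`, so their type does not
      -- depend on `v` and the searches for two families run over the same list.
      evaluate : Vec ∣ B.universe ∣ N → Generatorᴬ → ∣ B.universe ∣
      evaluate w g = maybe (lookup w) default (rep g)

      preservesAll : Vec ∣ B.universe ∣ N → Bool
      preservesAll w = all (λ p → B.rel (proj₁ p) (Vec.tabulate (evaluate w ∘ coordinate p))) relators

      -- LevelSolves may return different solutions for families v equal up to ≈, which the
      -- search excludes.
      solution : Maybe (Vec ∣ B.universe ∣ N)
      solution = findᵇ preservesAll (tuples (elements B.universe) N)

      canonical : Generatorᴬ → ∣ B.universe ∣
      canonical g = maybe (λ w → evaluate w g) default solution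

      canonical-cong : ∀ {g h} → g ∼ h → canonical g ≡ canonical h
      canonical-cong {g} {h} g∼h =
        cong (λ j → maybe (λ w → maybe (lookup w) default j) default solution) (rep-cong {g} {h} g∼h)

      -- Indices outside `classes` may take the value `default`, because `evaluate` consults the
      -- assignment only at representatives.
      preservesAll-∃ : SolutionIn 𝔹 classInstance → ∃[ w ] T (preservesAll w)
      preservesAll-∃ s = w , ListAllₚ.all⁻ _ (ListAll.map
          (λ {p} → subst (T ∘ B.rel (proj₁ p)) (trans (sym (Vecₚ.tabulate-∘ value (class p)))
            (Vecₚ.tabulate-cong λ i → sym (evaluate-class p i))))
          (ListAllₚ.map⁻ satisfies))
        where
        open SolutionIn s

        extended : Fin N → ∣ B.universe ∣
        extended j with T? (isRep j)
        ... | yes t = value (j , t)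
        ... | no _  = default

        w : Vec ∣ B.universe ∣ N
        w = Vec.tabulate extended

        extended-class : ∀ x → extended (proj₁ x) ≡ value x
        extended-class (j , t) with T? (isRep j)
        ... | yes t′ = cong (λ t → value (j , t)) (T-irrelevant t′ t)
        ... | no ¬t  = contradiction t ¬t

        evaluate-class : ∀ p i → evaluate w (coordinate p i) ≡ value (class p i)
        evaluate-class p i = trans (cong (maybe (lookup w) default) (rep-class p i))
          (trans (Vecₚ.lookup∘tabulate extended _) (extended-class (class p i)))

      -- `solves` provides only the existence of a good assignment, which makes the search succeed.
      -- The relator `p` need not be listed, but one with a pointwise equal `τ′` is, and its
      -- coordinates are equivalent to those of `p`.
      canonical-preserves : LevelSolves (suc n) 𝓡 𝕋 → Reindexed 𝓔 v →
        ∀ p → T (B.rel (proj₁ p) (Vec.tabulate (canonical ∘ coordinate p)))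
      canonical-preserves solves re p@(R , z , τ)
        with w₀ , good₀ ← preservesAll-∃ (solves classInstance (classSolution re))
        with w , eq , good ← findᵇ-∃ preservesAll
               (∈-tuples⁺ (All.universal (∈-elements B.universe) w₀)) good₀
        with τ′ , p∈ , τ′≗τ ← ∈-relators R z τ =
        subst (T ∘ B.rel R)
          (Vecₚ.tabulate-cong λ i → trans
            (cong (maybe (λ w → evaluate w (coordinate (R , z , τ′) i)) default) (sym eq))
            (canonical-cong {coordinate (R , z , τ′) i} {coordinate p i}
              (≗⇒∼ {A.universe} λ e → cong (λ u → lookup (proj₁ u) i) (τ′≗τ e))))
          (ListAll.lookup (ListAllₚ.all⁺ _ relators good) p∈)

    -- Independence of the representative of a family up to `≈`.

    module _ {v v′ : Family 𝓔 (suc n)} (v≈v′ : ∀ xs → _≈_ {∏ dom xs} (v xs) (v′ xs)) where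

      induced-resp : ∀ {C} (g : Generators.Generator 𝓔 v C) ys →
        _≈_ {C ×ᶠ ∏ dom ys} (Generators.induced 𝓔 v {C} g ys) (Generators.induced 𝓔 v′ {C} g ys)
      induced-resp {C} (z , β) ys = Eq.trans (C ×ᶠ ∏ dom ys)
        (map-resp (Generators.applyHead 𝓔 v {C} β) (v≈v′ (z ∷ ys)))
        (Minion.map-cong 𝓡 (λ { (e ∷ es) → refl }) _)

      ∼-resp : ∀ {g h} → _∼_ v g h → _∼_ v′ g h
      ∼-resp {g} {h} g∼h ys = begin
        _ ≈⟨ induced-resp {A.universe} g ys ⟨
        _ ≈⟨ g∼h ys ⟩
        _ ≈⟨ induced-resp {A.universe} h ys ⟩
        _ ∎
        where open SetoidReasoning (obj (A.universe ×ᶠ ∏ dom ys))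

    module _ {v v′ : Family 𝓔 (suc n)} (v≈v′ : ∀ xs → _≈_ {∏ dom xs} (v xs) (v′ xs)) where

      opaque
        unfolding rep

        rep-resp : rep v ≗ rep v′
        rep-resp g = findᵇ-cong (λ j → does-⇔
          (mk⇔ (∼-resp v≈v′ {nth j} {g})
               (∼-resp (λ xs → Eq.sym (∏ dom xs) (v≈v′ xs)) {nth j} {g})) em em) (List.allFin N)

      evaluate-resp : ∀ w → evaluate v w ≗ evaluate v′ w
      evaluate-resp w g = cong (maybe (lookup w) (default v)) (rep-resp g)

      solution-resp : solution v ≡ solution v′
      solution-resp = findᵇ-cong (λ w → all-cong
        (λ p → cong (B.rel (proj₁ p)) (Vecₚ.tabulate-cong (evaluate-resp w ∘ coordinate p))) relators)
        (tuples (elements B.universe) N)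

      -- Both searches depend on the family only through the truth values of `∼`, which are the same
      -- for `v` and `v′`.
      canonical-resp : canonical v ≗ canonical v′
      canonical-resp g = trans
        (cong (λ j → maybe (λ w → maybe (lookup w) (default v) j) (default v) (solution v)) (rep-resp g))
        (cong (maybe (λ w → evaluate v′ w g) (default v)) solution-resp)

  -- The homomorphism into the polymorphism minion.

  module _ (solves : LevelSolves (suc n) 𝓡 𝕋) where
    open Scopes

    reindexed : ∀ {C} (t : L.Elem C) → Reindexed (Triple.𝓔 t) (Solution.value (Triple.r t))
    reindexed t = proj₂ (satisfies⁻ (Triple.𝓔 t) _ (Solution.satisfies (Triple.r t)))

    polymorphism : ∀ {C} → L.Elem C → Polymorphism 𝔸 𝔹 C
    polymorphism {C} t@(triple 𝓔 d r ω (z , β , _)) = record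
      { fun       = λ a → canonical 𝓔 v (z , a ∘ β)
      ; fun-cong  = λ {a} {b} a≗b → canonical-cong 𝓔 v {z , a ∘ β} {z , b ∘ β}
                      (Generators.≗⇒∼ 𝓔 v {A.universe} (a≗b ∘ β))
      ; preserves = λ R as as-rel → subst (T ∘ B.rel R)
          (trans
            (Vecₚ.tabulate-cong λ i → canonical-cong 𝓔 v
              (Generators.≗⇒∼ 𝓔 v {A.universe} (λ e → Vecₚ.lookup-map i (λ a → a (β e)) as)))
            (trans (Vecₚ.tabulate-∘ (λ a → canonical 𝓔 v (z , a ∘ β)) (lookup as))
              (cong (Vec.map _) (Vecₚ.tabulate∘lookup as))))
          -- Evaluating `as` at `β e` gives a tuple of the relation for every `e`, hence a relator
          -- whose coordinates are the generators `a ∘ β` for `a` in `as`.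
          (canonical-preserves 𝓔 v solves (reindexed t)
            (R , z , λ e → Vec.map (λ a → a (β e)) as , as-rel (β e)))
      }
      where v = Solution.value r

    -- Equal triples may differ in `r` up to `≈` and in the inducing generator. After passing to
    -- `r′`, both generators induce the same `ω`, and pushing along `a` keeps them equivalent.
    polymorphism-resp : ∀ {C} {s t : L.Elem C} → L._≈_ {C} s t →
                        Polymorphism.fun (polymorphism s) ≗ Polymorphism.fun (polymorphism t)
    polymorphism-resp {C}
      (same {𝓔} {r = r} {r′} {i = z , β , eq} {i′ = z′ , β′ , eq′} r≈r′ ω≈ω′) a =
      trans (canonical-resp 𝓔 r≈r′ (z , a ∘ β))
        (canonical-cong 𝓔 v′ (push-∼ {C} {A.universe} a {z , β} {z′ , β′} equivalent))
      where
      open LC 𝓔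
      v′ = Solution.value r′
      open Generators 𝓔 v′ using (push-∼)

      equivalent : Generators._∼_ 𝓔 v′ {C} (z , β) (z′ , β′)
      equivalent ys = begin
        _ ≈⟨ induced-resp 𝓔 r≈r′ {C} (z , β) ys ⟨
        _ ≈⟨ Minion.map-cong 𝓡 (λ { (e ∷ es) → refl }) _ ⟩
        _ ≈⟨ eq ys ⟨
        _ ≈⟨ ω≈ω′ ys ⟩
        _ ≈⟨ eq′ ys ⟩
        _ ≈⟨ Minion.map-cong 𝓡 (λ { (e ∷ es) → refl }) _ ⟩
        _ ∎
        where open SetoidReasoning (obj (C ×ᶠ ∏ dom ys))

    solvesHom : MinionHom (lvlSuc n 𝓡) (Pol 𝔸 𝔹)
    solvesHom = record
      { ξ       = λ _ → polymorphism
      ; ξ-resp  = λ _ → polymorphism-resp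
      -- Mapping a triple along `α` turns `β` into `α ∘ β`, so both sides evaluate `canonical` at
      -- the same generator.
      ; natural = λ _ _ _ → refl
      }

corollary6p12 : ∀ {c ℓ} → ExcludedMiddle ℓ →
    (𝓡 : Minion c ℓ) (k : ℕ) .{{_ : NonZero k}} (𝕋 : PCSPTemplate) →
    LevelSolves k 𝓡 𝕋 ⇔ MinionHom (lvl k 𝓡) (Pol (PCSPTemplate.𝔸 𝕋) (PCSPTemplate.𝔹 𝕋))
corollary6p12 em 𝓡 zero    𝕋 = contradiction refl (≢-nonZero⁻¹ 0)
corollary6p12 em 𝓡 (suc n) 𝕋 =
  mk⇔ (CanonicalSolution.solvesHom em 𝓡 n 𝕋) (HomomorphismSolves.homSolves 𝓡 n 𝕋)
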